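{- For every integer $t\geq 4$, every graph $G$ that does not contain $K_t$ as a minor is $(t-1)$-colourable with defect $t-2$.
   Context: All graphs are finite and simple. A graph $G$ is $k$-colourable with defect $d$ if each vertex can be assigned one of $k$ colours (not necessarily properly) such that each vertex is adjacent to at most $d$ vertices of its own colour, i.e. each monochromatic subgraph has maximum degree at most $d$. -}

module Defs where

open import Data.Nat using (ℕ; zero; suc; _≤_)
open import Data.Fin using (Fin)
open import Data.Fin.Properties using (_≟_)
open import Data.Bool using (Bool; true; false; _∧_)
open import Data.Maybe using (Maybe; just; nothing)
open import Data.List using (List; []; _∷_; length; filter; allFin)
open import Data.Product using (Σ; _×_; _,_; ∃)
open import Relation.Binary.PropositionalEquality using (_≡_)
open import Relation.Nullary using (¬_)
open import Relation.Nullary.Decidable using (⌊_⌋)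

record Graph : Set where
  field
    n     : ℕ
    adj   : Fin n → Fin n → Bool
    sym   : ∀ u v → adj u v ≡ adj v u
    irrefl : ∀ v → adj v v ≡ false
open Graph public

data WalkIn (G : Graph) (P : Fin (n G) → Set) : Fin (n G) → Fin (n G) → Set where
  here : ∀ {u} → P u → WalkIn G P u u
  step : ∀ {u w v} → P u → adj G u w ≡ true → WalkIn G P w v → WalkIn G P u v

-- K_t minor model: a partial map β assigning vertices to branch sets
-- (so branch sets are automatically pairwise disjoint), with each branch
-- set nonempty, connected (in the induced subgraph), and every two distinct
-- branch sets joined by an edge.
record KMinorModel (t : ℕ) (G : Graph) : Set where
  field
    β         : Fin (n G) → Maybe (Fin t)
    nonempty  : ∀ i → ∃ λ v → β v ≡ just i
    connected : ∀ i u v → β u ≡ just i → β v ≡ just i →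
                WalkIn G (λ w → β w ≡ just i) u v
    adjacent  : ∀ i j → ¬ i ≡ j →
                Σ (Fin (n G)) λ u → Σ (Fin (n G)) λ v →
                  β u ≡ just i × β v ≡ just j × adj G u v ≡ true

HasKMinor : ℕ → Graph → Set
HasKMinor t G = KMinorModel t G

sameColourDegree : (G : Graph) {k : ℕ} → (Fin (n G) → Fin k) → Fin (n G) → ℕ
sameColourDegree G c v =
  length (filter (λ u → adj G v u ∧ ⌊ c u ≟ c v ⌋ ≟b true) (allFin (n G)))
  where
    open import Data.Bool.Properties renaming (_≟_ to _≟b_)

DefectColourable : ℕ → ℕ → Graph → Set
DefectColourable k d G =
  Σ (Fin (n G) → Fin k) λ c → ∀ v → sameColourDegree G c v ≤ d

{-# OPTIONS --safe #-}

-- The vertices are split greedily into connected pieces, keeping the invariant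
-- that the pieces touching one component C of the remaining graph touch each
-- other. Together with C they form a complete minor, so there are at most
-- t − 2 of them. Choose in C one neighbour of each, and take a minimal
-- connected subset H of C containing these terminals as the next piece. A
-- vertex of degree m in H yields m vertices other than it whose individual
-- removal leaves H connected (the ends of the branches of a spanning tree);
-- by minimality they are all terminals, so m ≤ t − 2. Since H touches at most
-- t − 2 earlier pieces, one of t − 1 colours is free for it.
module Submission where

open import Defs
open import Data.Nat using (ℕ; zero; suc; _≤_; _<_; _∸_; s≤s)
open import Data.Nat.Properties using (_≤?_; _<?_; ≰⇒>; ≮⇒≥; ≤-trans; <⇒≱)
open import Data.Bool using (true; false; if_then_else_; _∧_)
open import Data.Bool.Properties using () renaming (_≟_ to _≟ᵇ_)
open import Data.Maybe using (Maybe; just; nothing)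
open import Data.Maybe.Properties using (just-injective)
open import Data.Fin using (Fin; zero; suc; inject≤)
open import Data.Fin.Properties using (_≟_; any?; injective⇒≤; inject≤-injective)
open import Data.Fin.Subset using (Subset; _∈_; _∉_; _⊆_; _⊂_; _∪_; ⁅_⁆; _─_; _-_; ⊤)
open import Data.Fin.Subset.Properties
  using (_∈?_; p⊆p∪q; q⊆p∪q; x∈p∪q⁻; x∈⁅x⁆; x∈⁅y⁆⇒x≡y; ⊆-trans; ⊆-antisym; ∈⊤; nonempty?;
         p─q⊆p; x∈p∧x∉q⇒x∈p─q; x∈p∧x≢y⇒x∈p-y; x∈p⇒p-x⊂p)
open import Data.Fin.Subset.Induction using (⊂-wellFounded; ⊃-wellFounded; Acc; acc)
open import Data.List using (List; length; filter; lookup; allFin)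
open import Data.List.Membership.Propositional using () renaming (_∈_ to _∈ˡ_)
open import Data.List.Membership.Propositional.Properties
  using (∈-lookup; ∈-filter⁺; ∈-filter⁻; ∈-allFin)
open import Data.List.Membership.Setoid.Properties using (index-injective)
open import Data.List.Relation.Unary.Any using (index)
open import Data.List.Relation.Unary.Any.Properties using (lookup-index)
open import Data.List.Relation.Unary.All using () renaming (lookup to All-lookup)
open import Data.List.Relation.Unary.AllPairs using (_∷_)
open import Data.List.Relation.Unary.Unique.Propositional using (Unique)
open import Data.List.Relation.Unary.Unique.Propositional.Properties using (allFin⁺; filter⁺)
open import Data.Vec using (tabulate; _∷_; here; there)
open import Data.Vec.Properties using (lookup⇒[]=; []=⇒lookup; lookup∘tabulate)
open import Data.Product using (Σ; ∃; _×_; _,_; proj₁; proj₂)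
open import Data.Sum using (_⊎_; inj₁; inj₂)
open import Function using (_∘_; id)
open import Function.Definitions using (Injective)
open import Level using (0ℓ)
open import Relation.Binary.PropositionalEquality
  using (_≡_; _≢_; refl; trans; cong; subst; setoid) renaming (sym to ≡-sym)
open import Relation.Nullary using (¬_; Dec; yes; no; does; contradiction)
open import Relation.Nullary.Decidable
  using (_×-dec_; _⊎-dec_; ¬?; decidable-stable; ⌊_⌋; dec-true; dec-false)
open import Relation.Unary using (Pred; Decidable)

-- Injections between finite sets, and subsets of `Fin n`.

lookup-injective : {A : Set} {xs : List A} → Unique xs → Injective _≡_ _≡_ (lookup xs)
lookup-injective (_    ∷ _) {zero}  {zero}  _  = refl
lookup-injective (x∉xs ∷ _) {zero}  {suc j} eq = contradiction eq (All-lookup x∉xs (∈-lookup j))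
lookup-injective (x∉xs ∷ _) {suc i} {zero}  eq =
  contradiction (≡-sym eq) (All-lookup x∉xs (∈-lookup i))
lookup-injective (_ ∷ xs!) {suc i} {suc j} eq = cong suc (lookup-injective xs! eq)

injective-∈⇒≤length : ∀ {A : Set} {m} {f : Fin m → A} {xs} → Injective _≡_ _≡_ f →
                      (∀ i → f i ∈ˡ xs) → m ≤ length xs
injective-∈⇒≤length f-inj f∈xs =
  injective⇒≤ (λ eq → f-inj (index-injective (setoid _) (f∈xs _) (f∈xs _) eq))

-- Pigeonhole: if `g` hit every `f i`, choosing preimages would inject `Fin m` into `Fin k`. It
-- serves twice, to find a removable vertex that is no terminal and to find a free colour.
injective-escapes : ∀ {m k n} (f : Fin m → Fin n) (g : Fin k → Fin n) →
                    Injective _≡_ _≡_ f → k < m → ∃ λ i → ∀ j → g j ≢ f i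
injective-escapes f g f-inj k<m with any? (λ i → ¬? (any? λ j → g j ≟ f i))
... | yes (i , gj≢fi) = i , λ j eq → gj≢fi (j , eq)
... | no ¬escape = contradiction (injective⇒≤ preimage-injective) (<⇒≱ k<m)
  where
  covered : ∀ i → ∃ λ j → g j ≡ f i
  covered i = decidable-stable (any? λ j → g j ≟ f i) (λ ¬c → ¬escape (i , ¬c))
  preimage-injective : Injective _≡_ _≡_ (proj₁ ∘ covered)
  preimage-injective {i} {j} eq =
    f-inj (trans (≡-sym (proj₂ (covered i))) (trans (cong g eq) (proj₂ (covered j))))

∈-∪⁅⁆ : ∀ {n} {p : Subset n} {x y} → x ∈ p ∪ ⁅ y ⁆ → x ∈ p ⊎ x ≡ y
∈-∪⁅⁆ {p = p} {y = y} x∈ with x∈p∪q⁻ p ⁅ y ⁆ x∈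
... | inj₁ x∈p = inj₁ x∈p
... | inj₂ x∈y = inj₂ (x∈⁅y⁆⇒x≡y y x∈y)

x∈p─q⇒x∉q : ∀ {n} {p q : Subset n} {x} → x ∈ p ─ q → x ∉ q
x∈p─q⇒x∉q {p = _ ∷ _} {false ∷ _} (there x∈p─q) (there x∈q) = x∈p─q⇒x∉q x∈p─q x∈q
x∈p─q⇒x∉q {p = _ ∷ _} {true  ∷ _} (there x∈p─q) (there x∈q) = x∈p─q⇒x∉q x∈p─q x∈q

x∈p-y⇒x≢y : ∀ {n} {p : Subset n} {x y} → x ∈ p - y → x ≢ y
x∈p-y⇒x≢y x∈p-x refl = x∈p─q⇒x∉q x∈p-x (x∈⁅x⁆ _)

module _ {n} {P : Pred (Fin n) 0ℓ} (P? : Decidable P) where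

  comprehension : Subset n
  comprehension = tabulate (does ∘ P?)

  ∈-comprehension⁺ : ∀ {x} → P x → x ∈ comprehension
  ∈-comprehension⁺ {x} Px =
    lookup⇒[]= x _ (trans (lookup∘tabulate _ x) (dec-true (P? x) Px))

  ∈-comprehension⁻ : ∀ {x} → x ∈ comprehension → P x
  ∈-comprehension⁻ {x} x∈ with P? x | trans (≡-sym (lookup∘tabulate (does ∘ P?) x)) ([]=⇒lookup x∈)
  ... | yes Px | _ = Px

  enumeration : List (Fin n)
  enumeration = filter P? (allFin n)

  enumeration-unique : Unique enumeration
  enumeration-unique = filter⁺ P? (allFin⁺ n)

  ∈-enumeration : ∀ {x} → P x → x ∈ˡ enumeration
  ∈-enumeration Px = ∈-filter⁺ P? (∈-allFin _) Px

  lookup-enumeration : ∀ i → P (lookup enumeration i)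
  lookup-enumeration i = proj₂ (∈-filter⁻ P? {xs = allFin n} (∈-lookup i))

module _ {A : Set} {n} (x : Fin n) (a : A) (f : Fin n → A) where

  update : Fin n → A
  update y = if does (y ≟ x) then a else f y

  update-≡ : update x ≡ a
  update-≡ rewrite dec-true (x ≟ x) refl = refl

  update-≢ : ∀ {y} → y ≢ x → update y ≡ f y
  update-≢ {y} y≢x rewrite dec-false (y ≟ x) y≢x = refl

-- Walks, touching vertex sets and minor models.

module _ (G : Graph) where

  private
    V : Set
    V = Fin (n G)

  infix 4 _~_ _~?_

  _~_ : V → V → Set
  u ~ v = adj G u v ≡ true

  _~?_ : ∀ u v → Dec (u ~ v)
  u ~? v = adj G u v ≟ᵇ true

  ~-sym : ∀ {u v} → u ~ v → v ~ u
  ~-sym {u} {v} u~v = trans (sym G v u) u~v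

  ~⇒≢ : ∀ {u v} → u ~ v → u ≢ v
  ~⇒≢ {u} u~u refl with trans (≡-sym (irrefl G u)) u~u
  ... | ()

  module _ {P : V → Set} where

    walk-source : ∀ {u v} → WalkIn G P u v → P u
    walk-source (here Pu)     = Pu
    walk-source (step Pu _ _) = Pu

    walk-trans : ∀ {u v w} → WalkIn G P u v → WalkIn G P v w → WalkIn G P u w
    walk-trans (here _)          q = q
    walk-trans (step Pu u~w p) q = step Pu u~w (walk-trans p q)

    walk-reverse : ∀ {u v} → WalkIn G P u v → WalkIn G P v u
    walk-reverse (here Pu)         = here Pu
    walk-reverse (step Pu u~w p) =
      walk-trans (walk-reverse p) (step (walk-source p) (~-sym u~w) (here Pu))

  walk-map : ∀ {P Q : V → Set} → (∀ {x} → P x → Q x) →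
             ∀ {u v} → WalkIn G P u v → WalkIn G Q u v
  walk-map P⊆Q (here Pu)       = here (P⊆Q Pu)
  walk-map P⊆Q (step Pu u~w p) = step (P⊆Q Pu) u~w (walk-map P⊆Q p)

  Touch : (P Q : V → Set) → Set
  Touch P Q = ∃ λ u → ∃ λ v → P u × Q v × u ~ v

  touch-sym : ∀ {P Q} → Touch P Q → Touch Q P
  touch-sym (u , v , Pu , Qv , u~v) = v , u , Qv , Pu , ~-sym u~v

  touch-map : ∀ {P P′ Q Q′ : V → Set} → (∀ {x} → P x → P′ x) → (∀ {x} → Q x → Q′ x) →
              Touch P Q → Touch P′ Q′
  touch-map f g (u , v , Pu , Qv , u~v) = u , v , f Pu , g Qv , u~v

  -- Phrased through injective families of neighbours instead of a count, so that the bound passes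
  -- to a smaller predicate without comparing lists.
  Degree≤ : ℕ → (V → Set) → V → Set
  Degree≤ d P v = ∀ {m} (f : Fin m → V) → Injective _≡_ _≡_ f →
                  (∀ i → v ~ f i × P (f i)) → m ≤ d

  -- `β` sends a vertex to the branch set that the search finds. By disjointness it is the only one,
  -- so `β⁺` and `β⁻` identify the fibres of `β` with the sets `B i`.
  kMinorModel : ∀ {t} (B : Fin t → V → Set) → (∀ i → Decidable (B i)) →
                (∀ {i j x} → B i x → B j x → i ≡ j) →
                (∀ i → ∃ (B i)) →
                (∀ i {u v} → B i u → B i v → WalkIn G (B i) u v) →
                (∀ {i j} → i ≢ j → Touch (B i) (B j)) →
                KMinorModel t G
  kMinorModel {t} B B? disjoint inhabited connected touching = record
    { β         = β
    ; nonempty  = λ i → proj₁ (inhabited i) , β⁺ (proj₂ (inhabited i))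
    ; connected = λ i u v βu βv → walk-map β⁺ (connected i (β⁻ βu) (β⁻ βv))
    ; adjacent  = λ i j i≢j → touch-map β⁺ β⁺ (touching i≢j)
    }
    where
    β : V → Maybe (Fin t)
    β x with any? (λ i → B? i x)
    ... | yes (i , _) = just i
    ... | no _        = nothing

    β⁺ : ∀ {i x} → B i x → β x ≡ just i
    β⁺ {i} {x} Bix with any? (λ i → B? i x)
    ... | yes (j , Bjx) = cong just (disjoint Bjx Bix)
    ... | no ¬B         = contradiction (i , Bix) ¬B

    β⁻ : ∀ {i x} → β x ≡ just i → B i x
    β⁻ {i} {x} eq with any? (λ i → B? i x)
    ... | yes (j , Bjx) = subst (λ k → B k x) (just-injective eq) Bjx
    β⁻ {i} {x} () | no _

  -- Closed sets, growth and connectedness.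

  ClosedIn : (S D : Subset (n G)) → Set
  ClosedIn S D = ∀ {c w} → c ∈ D → w ∈ S → c ~ w → w ∈ D

  closed-walk : ∀ {S D u v} → ClosedIn S D → u ∈ D → WalkIn G (_∈ S) u v → v ∈ D
  closed-walk closed u∈D (here _)       = u∈D
  closed-walk closed u∈D (step _ u~w p) =
    closed-walk closed (closed u∈D (walk-source p) u~w) p

  -- While an edge leads from `D` to a vertex of `S` outside `D`, that vertex is added; finiteness
  -- ends the process. This yields components, and later extends a star to a whole connected set.
  grow : ∀ (P : Subset (n G) → Set) S →
         (∀ {D c w} → P D → c ∈ D → w ∈ S → w ∉ D → c ~ w → P (D ∪ ⁅ w ⁆)) →
         ∀ D → D ⊆ S → P D → ∃ λ D′ → D′ ⊆ S × ClosedIn S D′ × P D′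
  grow P S P-step D = go D (⊃-wellFounded D)
    where
    go : ∀ D → Acc _ D → D ⊆ S → P D → ∃ λ D′ → D′ ⊆ S × ClosedIn S D′ × P D′
    go D (acc rec) D⊆S PD
      with any? (λ c → any? λ w → (c ∈? D) ×-dec (w ∈? S) ×-dec ¬? (w ∈? D) ×-dec (c ~? w))
    ... | yes (c , w , c∈D , w∈S , w∉D , c~w) =
          go (D ∪ ⁅ w ⁆) (rec ((λ {_} → p⊆p∪q ⁅ w ⁆) , w , q⊆p∪q D ⁅ w ⁆ (x∈⁅x⁆ w) , w∉D)) ∪⊆S
             (P-step PD c∈D w∈S w∉D c~w)
      where
      ∪⊆S : D ∪ ⁅ w ⁆ ⊆ S
      ∪⊆S x∈ with ∈-∪⁅⁆ {p = D} x∈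
      ... | inj₁ x∈D  = D⊆S x∈D
      ... | inj₂ refl = w∈S
    ... | no ¬frontier = D , D⊆S , closed , PD
      where
      closed : ClosedIn S D
      closed {c} {w} c∈D w∈S c~w =
        decidable-stable (w ∈? D) (λ w∉D → ¬frontier (c , w , c∈D , w∈S , w∉D , c~w))

  -- Connectedness of the subgraph induced by `D`, seen from a root: one walk per vertex suffices,
  -- and the root shows that `D` is nonempty.
  Spans : V → Subset (n G) → Set
  Spans v D = v ∈ D × (∀ {u} → u ∈ D → WalkIn G (_∈ D) v u)

  spans-connected : ∀ {r D u v} → Spans r D → u ∈ D → v ∈ D → WalkIn G (_∈ D) u v
  spans-connected (_ , walk) u∈D v∈D = walk-trans (walk-reverse (walk u∈D)) (walk v∈D)

  spans-reroot : ∀ {r v D} → Spans r D → v ∈ D → Spans v D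
  spans-reroot r v∈D = v∈D , spans-connected r v∈D

  spans-resp : ∀ {v D E} → Spans v D → D ⊆ E → E ⊆ D → Spans v E
  spans-resp (v∈D , walk) D⊆E E⊆D = D⊆E v∈D , walk-map D⊆E ∘ walk ∘ E⊆D

  -- `E` is given by inclusions, so that it may be `(D ∪ ⁅ w ⁆) - l` as well as `D ∪ ⁅ w ⁆`.
  spans-extend : ∀ {v c w D E} → Spans v D → c ∈ D → c ~ w → D ⊆ E → w ∈ E →
                 (∀ {x} → x ∈ E → x ∈ D ⊎ x ≡ w) → Spans v E
  spans-extend {v} {c} {w} {D} {E} (v∈D , walk) c∈D c~w D⊆E w∈E E⊆D∪w = D⊆E v∈D , walk′
    where
    walk′ : ∀ {u} → u ∈ E → WalkIn G (_∈ E) v u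
    walk′ u∈E with E⊆D∪w u∈E
    ... | inj₁ u∈D  = walk-map D⊆E (walk u∈D)
    ... | inj₂ refl =
      walk-trans (walk-map D⊆E (walk c∈D)) (step (D⊆E c∈D) c~w (here w∈E))

  spans-∪ : ∀ {v c w D} → Spans v D → c ∈ D → c ~ w → Spans v (D ∪ ⁅ w ⁆)
  spans-∪ {w = w} {D} spans c∈D c~w =
    spans-extend spans c∈D c~w (p⊆p∪q ⁅ w ⁆) (q⊆p∪q D ⁅ w ⁆ (x∈⁅x⁆ w)) ∈-∪⁅⁆

  component : ∀ {U x} → x ∈ U → ∃ λ C → C ⊆ U × ClosedIn U C × Spans x C
  component {U} {x} x∈U =
    grow (Spans x) U (λ spans c∈D _ _ c~w → spans-∪ spans c∈D c~w) ⁅ x ⁆ ⁅x⁆⊆U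
      (x∈⁅x⁆ x , λ u∈ → subst (WalkIn G _ x) (≡-sym (x∈⁅y⁆⇒x≡y x u∈)) (here (x∈⁅x⁆ x)))
    where
    ⁅x⁆⊆U : ⁅ x ⁆ ⊆ U
    ⁅x⁆⊆U u∈ rewrite x∈⁅y⁆⇒x≡y x u∈ = x∈U

  -- Removable vertices and connectors of small degree.

  Removable : ℕ → V → Subset (n G) → Set
  Removable m v D = Σ (Fin m → V) λ g →
                    Injective _≡_ _≡_ g × ∀ i → g i ∈ D × Spans v (D - g i)

  -- When w is attached to c, it takes over the role of c, should c be one of the
  -- removable vertices.
  removable-∪ : ∀ {m v c w D} → Spans v D → c ∈ D → w ∉ D → c ~ w →
                Removable m v D → Removable m v (D ∪ ⁅ w ⁆)
  removable-∪ {m} {v} {c} {w} {D} spans c∈D w∉D c~w (g , g-inj , g-rem) =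
    σ ∘ g , (λ eq → g-inj (σ-injective (proj₁ (g-rem _)) (proj₁ (g-rem _)) eq)) ,
    λ i → σ-removable (proj₁ (g-rem i)) (proj₂ (g-rem i))
    where
    σ : V → V
    σ = update c w id

    w∈ : w ∈ D ∪ ⁅ w ⁆
    w∈ = q⊆p∪q D ⁅ w ⁆ (x∈⁅x⁆ w)

    σ-injective : ∀ {x y} → x ∈ D → y ∈ D → σ x ≡ σ y → x ≡ y
    σ-injective {x} {y} x∈D y∈D eq with x ≟ c | y ≟ c
    ... | yes refl | yes refl = refl
    ... | yes refl | no  _    = contradiction (subst (_∈ D) (≡-sym eq) y∈D) w∉D
    ... | no  _    | yes refl = contradiction (subst (_∈ D) eq x∈D) w∉D
    ... | no  _    | no  _    = eq

    σ-removable : ∀ {l} → l ∈ D → Spans v (D - l) →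
                  σ l ∈ D ∪ ⁅ w ⁆ × Spans v ((D ∪ ⁅ w ⁆) - σ l)
    σ-removable {l} l∈D spans-l with l ≟ c
    -- Here `σ l` is `w`, and deleting `w` gives back the connected set `D`.
    ... | yes refl = w∈ , spans-resp spans D⊆ ⊆D
      where
      D⊆ : D ⊆ (D ∪ ⁅ w ⁆) - w
      D⊆ x∈D = x∈p∧x≢y⇒x∈p-y (p⊆p∪q ⁅ w ⁆ x∈D) λ {refl → w∉D x∈D}
      ⊆D : (D ∪ ⁅ w ⁆) - w ⊆ D
      ⊆D x∈ with ∈-∪⁅⁆ {p = D} (p─q⊆p (D ∪ ⁅ w ⁆) ⁅ w ⁆ x∈)
      ... | inj₁ x∈D = x∈D
      ... | inj₂ x≡w = contradiction x≡w (x∈p-y⇒x≢y {p = D ∪ ⁅ w ⁆} x∈)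
    -- Here `σ l` is `l`; since `c` survives the deletion, `w` stays attached to it.
    ... | no l≢c = p⊆p∪q ⁅ w ⁆ l∈D ,
                   spans-extend spans-l (x∈p∧x≢y⇒x∈p-y c∈D (l≢c ∘ ≡-sym)) c~w ⊆E
                     (x∈p∧x≢y⇒x∈p-y w∈ λ {refl → w∉D l∈D}) E⊆
      where
      ⊆E : D - l ⊆ (D ∪ ⁅ w ⁆) - l
      ⊆E x∈ = x∈p∧x≢y⇒x∈p-y (p⊆p∪q ⁅ w ⁆ (p─q⊆p D ⁅ l ⁆ x∈)) (x∈p-y⇒x≢y {p = D} x∈)
      E⊆ : ∀ {x} → x ∈ (D ∪ ⁅ w ⁆) - l → x ∈ D - l ⊎ x ≡ w
      E⊆ x∈ with ∈-∪⁅⁆ {p = D} (p─q⊆p (D ∪ ⁅ w ⁆) ⁅ l ⁆ x∈)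
      ... | inj₁ x∈D = inj₁ (x∈p∧x≢y⇒x∈p-y x∈D (x∈p-y⇒x≢y {p = D ∪ ⁅ w ⁆} x∈))
      ... | inj₂ x≡w = inj₂ x≡w

  -- In the star formed by `v` and the vertices `f i`, every `f i` is removable. The rest of `S` is
  -- attached one vertex at a time, and `removable-∪` preserves the number of removable vertices.
  neighbours⇒removable : ∀ {m v S} → Spans v S → (f : Fin m → V) → Injective _≡_ _≡_ f →
                         (∀ i → v ~ f i × f i ∈ S) → Removable m v S
  neighbours⇒removable {m} {v} {S} (v∈S , walk) f f-inj f-nbr
    with grow (λ D → Spans v D × Removable m v D) S
           (λ (spans , rem) c∈D _ w∉D c~w → spans-∪ spans c∈D c~w ,
                                            removable-∪ spans c∈D w∉D c~w rem)
           star star⊆S (star-spans , f , f-inj , star-removable)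
    where
    InStar : V → Set
    InStar u = u ≡ v ⊎ ∃ λ i → f i ≡ u

    star? : Decidable InStar
    star? u = (u ≟ v) ⊎-dec any? (λ i → f i ≟ u)

    star : Subset (n G)
    star = comprehension star?

    ∈star : ∀ {u} → InStar u → u ∈ star
    ∈star = ∈-comprehension⁺ star?

    star⊆S : star ⊆ S
    star⊆S u∈ with ∈-comprehension⁻ star? u∈
    ... | inj₁ refl       = v∈S
    ... | inj₂ (i , refl) = proj₂ (f-nbr i)

    -- Stated for subsets, to cover both the star and the star without one of its ends.
    spans-substar : ∀ {D} → D ⊆ star → v ∈ D → Spans v D
    spans-substar {D} D⊆star v∈D = v∈D , walk′
      where
      walk′ : ∀ {u} → u ∈ D → WalkIn G (_∈ D) v u
      walk′ u∈D with ∈-comprehension⁻ star? (D⊆star u∈D)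
      ... | inj₁ refl       = here v∈D
      ... | inj₂ (i , refl) = step v∈D (proj₁ (f-nbr i)) (here u∈D)

    star-spans : Spans v star
    star-spans = spans-substar id (∈star (inj₁ refl))

    star-removable : ∀ i → f i ∈ star × Spans v (star - f i)
    star-removable i = ∈star (inj₂ (i , refl)) ,
      spans-substar (p─q⊆p star ⁅ f i ⁆)
        (x∈p∧x≢y⇒x∈p-y (∈star (inj₁ refl)) (~⇒≢ (proj₁ (f-nbr i))))
  ... | D , D⊆S , closed , (v∈D , _) , rem =
    -- A nonempty closed subset of the connected set `S` is all of `S`.
    subst (Removable m v) (⊆-antisym D⊆S (λ u∈S → closed-walk closed v∈D (walk u∈S))) rem

  -- A vertex of degree above `k` yields more than `k` removable vertices, so one of them is no
  -- terminal and can be deleted. Deletion stops once all degrees are at most `k`, possibly before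
  -- `H` is inclusion-minimal.
  connector : ∀ {k r} S → Spans r S → (T : Fin k → V) → (∀ j → T j ∈ S) →
              ∃ λ H → ∃ λ h → Spans h H × H ⊆ S × (∀ j → T j ∈ H) ×
              (∀ {v} → v ∈ H → Degree≤ k (_∈ H) v)
  connector {k} S spans T = go S (⊂-wellFounded S) spans
    where
    nbr? : ∀ S v → Decidable (λ u → v ~ u × u ∈ S)
    nbr? S v u = (v ~? u) ×-dec (u ∈? S)

    go : ∀ {r} S → Acc _⊂_ S → Spans r S → (∀ j → T j ∈ S) →
         ∃ λ H → ∃ λ h → Spans h H × H ⊆ S × (∀ j → T j ∈ H) ×
         (∀ {v} → v ∈ H → Degree≤ k (_∈ H) v)
    go {r} S (acc rec) spans T∈S
      with any? (λ v → (v ∈? S) ×-dec (k <? length (enumeration (nbr? S v))))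
    ... | no ¬large = S , r , spans , id , T∈S , λ {v} v∈S f f-inj f-nbr →
          ≤-trans (injective-∈⇒≤length f-inj (∈-enumeration (nbr? S v) ∘ f-nbr))
                  (≮⇒≥ (λ k< → ¬large (v , v∈S , k<)))
    ... | yes (v , v∈S , k<deg)
      with neighbours⇒removable (spans-reroot spans v∈S) (lookup (enumeration (nbr? S v)))
             (lookup-injective (enumeration-unique (nbr? S v))) (lookup-enumeration (nbr? S v))
    ... | g , g-inj , g-rem with injective-escapes g T g-inj k<deg
    ... | i , T≢gi
      with go (S - g i) (rec (x∈p⇒p-x⊂p (proj₁ (g-rem i)))) (proj₂ (g-rem i))
              (λ j → x∈p∧x≢y⇒x∈p-y (T∈S j) (T≢gi j))
    ... | H , h , spans-h , H⊆ , T∈H , deg =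
          H , h , spans-h , ⊆-trans H⊆ (p─q⊆p S ⁅ g i ⁆) , T∈H , deg

  -- Partial partitions into connected pieces.

  Piece : Subset (n G) → (V → V) → V → V → Set
  Piece U rep r x = x ∉ U × rep x ≡ r

  -- U is the set of vertices not yet in a piece. A piece is named by one of its
  -- vertices, so that a vertex of U is always a fresh name.
  record PartialPartition (d : ℕ) (U : Subset (n G)) : Set where
    field
      rep       : V → V
      col       : V → Fin (suc d)
      name∉     : ∀ {r x} → Piece U rep r x → r ∉ U
      connected : ∀ {r u v} → Piece U rep r u → Piece U rep r v →
                  WalkIn G (Piece U rep r) u v
      degree    : ∀ {r v} → Piece U rep r v → Degree≤ d (Piece U rep r) v
      -- This confines each monochromatic component to a single piece, where `degree` bounds the
      -- defect.
      proper    : ∀ {r q} → r ≢ q → Touch (Piece U rep r) (Piece U rep q) → col r ≢ col q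
      -- The walk expresses that `u` and `v` lie in one component of the graph left on `U`.
      clique    : ∀ {r q u v a b} → r ≢ q → WalkIn G (_∈ U) u v → u ~ a → v ~ b →
                  Piece U rep r a → Piece U rep q b →
                  Touch (Piece U rep r) (Piece U rep q)

  -- Adding a piece inside one component of the remaining graph.

  module _ {d U} (state : PartialPartition d U)
           {C x} (C⊆U : C ⊆ U) (closed : ClosedIn U C) (spansC : Spans x C) where

    open PartialPartition state

    private
      Q : V → V → Set
      Q = Piece U rep

      Adjacent : V → Set
      Adjacent r = Touch (_∈ C) (Q r)

      Q? : ∀ r → Decidable (Q r)
      Q? r p = ¬? (p ∈? U) ×-dec (rep p ≟ r)

      adjacent? : Decidable Adjacent
      adjacent? r = any? λ c → any? λ p → (c ∈? C) ×-dec Q? r p ×-dec (c ~? p)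

      names : List V
      names = enumeration adjacent?

      adjacent-names : ∀ j → Adjacent (lookup names j)
      adjacent-names = lookup-enumeration adjacent?

      names-complete : ∀ {r} → Adjacent r → ∃ λ j → lookup names j ≡ r
      names-complete adj-r = index r∈ , ≡-sym (lookup-index r∈)
        where r∈ = ∈-enumeration adjacent? adj-r

    -- `C` is connected and lies in `U`, so it carries the walk that `clique` asks for.
    adjacent-pieces-touch : ∀ {r q} → r ≢ q → Adjacent r → Adjacent q → Touch (Q r) (Q q)
    adjacent-pieces-touch r≢q (c , a , c∈C , Qa , c~a) (c′ , b , c′∈C , Qb , c′~b) =
      clique r≢q (walk-map C⊆U (spans-connected spansC c∈C c′∈C)) c~a c′~b Qa Qb

    -- The first `suc d` adjacent pieces touch each other and `C`, so `C` as one more branch set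
    -- completes the model.
    component-minor : d < length names → HasKMinor (suc (suc d)) G
    component-minor d<∣names∣ =
      kMinorModel B B? B-disjoint B-inhabited B-connected B-touching
      where
      name : Fin (suc d) → V
      name i = lookup names (inject≤ i d<∣names∣)

      name-injective : Injective _≡_ _≡_ name
      name-injective {i} {j} eq = inject≤-injective d<∣names∣ d<∣names∣ i j
        (lookup-injective (enumeration-unique adjacent?) eq)

      adjacent-name : ∀ i → Adjacent (name i)
      adjacent-name i = adjacent-names (inject≤ i d<∣names∣)

      B : Fin (suc (suc d)) → V → Set
      B zero    = _∈ C
      B (suc i) = Q (name i)

      B? : ∀ i → Decidable (B i)
      B? zero    = _∈? C
      B? (suc i) = Q? (name i)

      B-disjoint : ∀ {i j v} → B i v → B j v → i ≡ j
      B-disjoint {zero}  {zero}  _         _         = refl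
      B-disjoint {zero}  {suc j} v∈C       (v∉U , _) = contradiction (C⊆U v∈C) v∉U
      B-disjoint {suc i} {zero}  (v∉U , _) v∈C       = contradiction (C⊆U v∈C) v∉U
      B-disjoint {suc i} {suc j} (_ , eq)  (_ , eq′) =
        cong suc (name-injective (trans (≡-sym eq) eq′))

      B-inhabited : ∀ i → ∃ (B i)
      B-inhabited zero    = x , proj₁ spansC
      B-inhabited (suc i) with adjacent-name i
      ... | _ , a , _ , Qa , _ = a , Qa

      B-connected : ∀ i {u v} → B i u → B i v → WalkIn G (B i) u v
      B-connected zero    = spans-connected spansC
      B-connected (suc i) = connected

      B-touching : ∀ {i j} → i ≢ j → Touch (B i) (B j)
      B-touching {zero}  {zero}  i≢j = contradiction refl i≢j
      B-touching {zero}  {suc j} _   = adjacent-name j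
      B-touching {suc i} {zero}  _   = touch-sym (adjacent-name i)
      B-touching {suc i} {suc j} i≢j =
        adjacent-pieces-touch (i≢j ∘ cong suc ∘ name-injective) (adjacent-name i) (adjacent-name j)

    module _ (few : length names ≤ d) {H h} (spansH : Spans h H) (H⊆C : H ⊆ C)
             (meets : ∀ j → Touch (_∈ H) (Q (lookup names j)))
             (degreeH : ∀ {v} → v ∈ H → Degree≤ (length names) (_∈ H) v) where

      private
        free : ∃ λ γ → ∀ j → col (lookup names j) ≢ γ
        -- The adjacent pieces occupy at most `d` of the `suc d` colours.
        free = injective-escapes id (col ∘ lookup names) id (s≤s few)

        γ : Fin (suc d)
        γ = proj₁ free

        h∈H : h ∈ H
        h∈H = proj₁ spansH

        U′ : Subset (n G)
        U′ = U ─ H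

        rep′ : V → V
        rep′ v = if does (v ∈? H) then h else rep v

        col′ : V → Fin (suc d)
        -- No existing piece is recoloured: names in use lie outside `U`, whereas `h` lies in `U`.
        col′ = update h γ col

        Q′ : V → V → Set
        Q′ = Piece U′ rep′

        U′⊆U : U′ ⊆ U
        U′⊆U = p─q⊆p U H

        H⇒Q′ : ∀ {v} → v ∈ H → Q′ h v
        H⇒Q′ {v} v∈H = (λ v∈U′ → x∈p─q⇒x∉q v∈U′ v∈H) , rep′≡h
          where
          rep′≡h : rep′ v ≡ h
          rep′≡h rewrite dec-true (v ∈? H) v∈H = refl

        Q⇒Q′ : ∀ {r v} → Q r v → Q′ r v
        Q⇒Q′ {r} {v} (v∉U , rep≡r) = v∉U ∘ U′⊆U , rep′≡r
          where
          rep′≡r : rep′ v ≡ r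
          rep′≡r rewrite dec-false (v ∈? H) (v∉U ∘ C⊆U ∘ H⊆C) = rep≡r

        Q′⇒ : ∀ {r v} → Q′ r v → (r ≡ h × v ∈ H) ⊎ (r ≢ h × Q r v)
        Q′⇒ {r} {v} (v∉U′ , rep′≡r) with v ∈? H
        ... | yes v∈H = inj₁ (≡-sym rep′≡r , v∈H)
        -- If the name of an old piece were `h`, it would lie in `U`, against `name∉`.
        ... | no v∉H  = inj₂ ((λ {refl → name∉ Qv (C⊆U (H⊆C h∈H))}) , Qv)
          where
          Qv : Q r v
          Qv = (λ v∈U → v∉U′ (x∈p∧x∉q⇒x∈p─q v∈U v∉H)) , rep′≡r

        Q′h⇒H : ∀ {v} → Q′ h v → v ∈ H
        Q′h⇒H Q′v with Q′⇒ Q′v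
        ... | inj₁ (_ , v∈H) = v∈H
        ... | inj₂ (h≢h , _) = contradiction refl h≢h

        Q′⇒Q : ∀ {r v} → r ≢ h → Q′ r v → Q r v
        Q′⇒Q r≢h Q′v with Q′⇒ Q′v
        ... | inj₁ (r≡h , _) = contradiction r≡h r≢h
        ... | inj₂ (_ , Qv)  = Qv

        H-touches : ∀ {q} → Adjacent q → Touch (Q′ h) (Q′ q)
        H-touches adj-q with names-complete adj-q
        ... | j , refl = touch-map H⇒Q′ Q⇒Q′ (meets j)

        γ-free : ∀ {q} → Adjacent q → col q ≢ γ
        γ-free adj-q with names-complete adj-q
        ... | j , refl = proj₂ free j

        -- A walk in `U` that starts next to `H` starts in `C`, because `C` is closed in `U`, and
        -- for the same reason never leaves `C`. Hence a piece next to its far end is adjacent to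
        -- `C`.
        reaches : ∀ {u v a b q} → WalkIn G (_∈ U) u v → u ~ a → a ∈ H → v ~ b → Q q b →
                  Adjacent q
        reaches {v = v} {b = b} p u~a a∈H v~b Qb = v , b , closed-walk closed u∈C p , Qb , v~b
          where u∈C = closed (H⊆C a∈H) (walk-source p) (~-sym u~a)

        name∉′ : ∀ {r v} → Q′ r v → r ∉ U′
        name∉′ Q′v with Q′⇒ Q′v
        ... | inj₁ (refl , _) = λ h∈U′ → x∈p─q⇒x∉q h∈U′ h∈H
        ... | inj₂ (_ , Qv)   = name∉ Qv ∘ U′⊆U

        connected′ : ∀ {r u v} → Q′ r u → Q′ r v → WalkIn G (Q′ r) u v
        connected′ {r} Q′u Q′v with r ≟ h
        ... | yes refl = walk-map H⇒Q′ (spans-connected spansH (Q′h⇒H Q′u) (Q′h⇒H Q′v))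
        ... | no r≢h   = walk-map Q⇒Q′ (connected (Q′⇒Q r≢h Q′u) (Q′⇒Q r≢h Q′v))

        degree′ : ∀ {r v} → Q′ r v → Degree≤ d (Q′ r) v
        degree′ {r} Q′v f f-inj f-nbr with r ≟ h
        ... | yes refl = ≤-trans (degreeH (Q′h⇒H Q′v) f f-inj
                           λ i → proj₁ (f-nbr i) , Q′h⇒H (proj₂ (f-nbr i))) few
        ... | no r≢h   = degree (Q′⇒Q r≢h Q′v) f f-inj
                           λ i → proj₁ (f-nbr i) , Q′⇒Q r≢h (proj₂ (f-nbr i))

        -- A piece touching `H` also touches `C`, so `γ` was chosen to differ from its colour.
        proper-H : ∀ {q} → q ≢ h → Touch (Q′ h) (Q′ q) → col′ q ≢ col′ h
        proper-H q≢h touch eq =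
          γ-free (touch-map (H⊆C ∘ Q′h⇒H) (Q′⇒Q q≢h) touch)
            (trans (≡-sym (update-≢ h γ col q≢h)) (trans eq (update-≡ h γ col)))

        proper′ : ∀ {r q} → r ≢ q → Touch (Q′ r) (Q′ q) → col′ r ≢ col′ q
        proper′ r≢q touch@(_ , _ , Q′a , Q′b , _) with Q′⇒ Q′a | Q′⇒ Q′b
        ... | inj₁ (refl , _) | inj₁ (refl , _) = contradiction refl r≢q
        ... | inj₁ (refl , _) | inj₂ (q≢h , _)  = proper-H q≢h touch ∘ ≡-sym
        ... | inj₂ (r≢h , _)  | inj₁ (refl , _) = proper-H r≢h (touch-sym touch)
        ... | inj₂ (r≢h , _)  | inj₂ (q≢h , _)  = λ eq →
              proper r≢q (touch-map (Q′⇒Q r≢h) (Q′⇒Q q≢h) touch)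
                (trans (≡-sym (update-≢ h γ col r≢h)) (trans eq (update-≢ h γ col q≢h)))

        -- Walks in `U′` are walks in `U`, so two old pieces inherit the condition. If one of the
        -- two is `H`, the other is adjacent to `C` by `reaches`, and `H` contains a terminal next
        -- to it.
        clique′ : ∀ {r q u v a b} → r ≢ q → WalkIn G (_∈ U′) u v → u ~ a → v ~ b →
                  Q′ r a → Q′ q b → Touch (Q′ r) (Q′ q)
        clique′ r≢q p u~a v~b Q′a Q′b with walk-map U′⊆U p | Q′⇒ Q′a | Q′⇒ Q′b
        ... | _ | inj₁ (refl , _)   | inj₁ (refl , _)   = contradiction refl r≢q
        ... | w | inj₁ (refl , a∈H) | inj₂ (_ , Qb)     = H-touches (reaches w u~a a∈H v~b Qb)
        ... | w | inj₂ (_ , Qa)     | inj₁ (refl , b∈H) =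
              touch-sym (H-touches (reaches (walk-reverse w) v~b b∈H u~a Qa))
        ... | w | inj₂ (_ , Qa)     | inj₂ (_ , Qb)     =
              touch-map Q⇒Q′ Q⇒Q′ (clique r≢q w u~a v~b Qa Qb)

      add-piece : ∃ λ U″ → U″ ⊂ U × PartialPartition d U″
      add-piece = U′ , (U′⊆U , h , C⊆U (H⊆C h∈H) , λ h∈U′ → x∈p─q⇒x∉q h∈U′ h∈H) , record
        { rep       = rep′
        ; col       = col′
        ; name∉     = name∉′
        ; connected = connected′
        ; degree    = degree′
        ; proper    = proper′
        ; clique    = clique′
        }

    minor-or-add-piece : HasKMinor (suc (suc d)) G ⊎ (∃ λ U′ → U′ ⊂ U × PartialPartition d U′)
    minor-or-add-piece with length names ≤? d
    ... | no ¬few = inj₁ (component-minor (≰⇒> ¬few))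
    ... | yes few
      -- The terminals are one neighbour in `C` for each adjacent piece. If there are none, the
      -- connector shrinks to a single vertex.
      with connector C spansC (proj₁ ∘ adjacent-names) (λ j → proj₁ (proj₂ (proj₂ (adjacent-names j))))
    ... | H , h , spansH , H⊆C , terminal∈H , degreeH =
          inj₂ (add-piece few spansH H⊆C meets degreeH)
      where
      meets : ∀ j → Touch (_∈ H) (Q (lookup names j))
      meets j with adjacent-names j | terminal∈H j
      ... | c , a , _ , Qa , c~a | c∈H = c , a , c∈H , Qa , c~a

  -- Exhausting the graph and reading off the colouring.

  complete-partition : ∀ {d} → ¬ HasKMinor (suc (suc d)) G → ∀ U → PartialPartition d U →
                       ∃ λ U′ → (∀ x → x ∉ U′) × PartialPartition d U′
  complete-partition {d} ¬minor U = go U (⊂-wellFounded U)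
    where
    go : ∀ U → Acc _⊂_ U → PartialPartition d U →
         ∃ λ U′ → (∀ x → x ∉ U′) × PartialPartition d U′
    go U (acc rec) state with nonempty? U
    ... | no empty = U , (λ x x∈U → empty (x , x∈U)) , state
    ... | yes (x , x∈U) with component x∈U
    ... | C , C⊆U , closed , spansC with minor-or-add-piece state C⊆U closed spansC
    ... | inj₁ minor              = contradiction minor ¬minor
    ... | inj₂ (U′ , U′⊂U , state′) = go U′ (rec U′⊂U) state′

  empty-partition : ∀ {d} → PartialPartition d ⊤
  empty-partition = record
    { rep       = id
    ; col       = λ _ → zero
    ; name∉     = λ (x∉⊤ , _) → contradiction ∈⊤ x∉⊤
    ; connected = λ (x∉⊤ , _) → contradiction ∈⊤ x∉⊤
    ; degree    = λ (x∉⊤ , _) → contradiction ∈⊤ x∉⊤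
    ; proper    = λ { _ (_ , _ , (x∉⊤ , _) , _) → contradiction ∈⊤ x∉⊤ }
    ; clique    = λ { _ _ _ _ (x∉⊤ , _) → contradiction ∈⊤ x∉⊤ }
    }

  -- Every vertex takes the colour of its piece. Adjacent vertices of one colour share a piece,
  -- since touching pieces differ in colour, so degrees inside pieces bound the defect.
  partition⇒colourable : ∀ {d U} → (∀ x → x ∉ U) → PartialPartition d U →
                         DefectColourable (suc d) d G
  partition⇒colourable {d} {U} ∉U state = c , bound
    where
    open PartialPartition state

    c : V → Fin (suc d)
    c = col ∘ rep

    same-colour? : ∀ v → Decidable (λ u → adj G v u ∧ ⌊ c u ≟ c v ⌋ ≡ true)
    same-colour? v u = adj G v u ∧ ⌊ c u ≟ c v ⌋ ≟ᵇ true

    same-colour⇒same-piece : ∀ {v u} → adj G v u ∧ ⌊ c u ≟ c v ⌋ ≡ true →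
                             v ~ u × Piece U rep (rep v) u
    same-colour⇒same-piece {v} {u} eq with adj G v u in v~u | c u ≟ c v
    ... | true | yes cu≡cv = refl , ∉U u , decidable-stable (rep u ≟ rep v) λ ru≢rv →
          proper ru≢rv (u , v , (∉U u , refl) , (∉U v , refl) , ~-sym v~u) cu≡cv

    bound : ∀ v → sameColourDegree G c v ≤ d
    bound v = degree (∉U v , refl) (lookup (enumeration (same-colour? v)))
      (lookup-injective (enumeration-unique (same-colour? v)))
      (same-colour⇒same-piece ∘ lookup-enumeration (same-colour? v))

  defect-colouring : ∀ {d} → ¬ HasKMinor (suc (suc d)) G → DefectColourable (suc d) d G
  defect-colouring ¬minor with complete-partition ¬minor ⊤ empty-partition
  ... | U , ∉U , state = partition⇒colourable ∉U state

theorem2 : (t : ℕ) → 4 ≤ t → (G : Graph) → ¬ HasKMinor t G →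
    DefectColourable (t ∸ 1) (t ∸ 2) G
theorem2 (suc zero) (s≤s ())
-- Matching `t` as `suc (suc d)` makes both truncated subtractions compute, to `suc d` and `d`.
theorem2 (suc (suc d)) _ G = defect-colouring G
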